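{- For any constant $\varepsilon>0$, there is no algorithm that succeeds with probability $\frac{1}{e}+\varepsilon$ for the best-choice prophet inequality problem; that is, no algorithm has success probability at least $\frac1e+\varepsilon$ on every instance.
   Context: Best-choice prophet inequality problem: an instance is a finite collection of probability distributions $D_1,\ldots,D_n$ on the real numbers ($n$ arbitrary), known to the algorithm in advance. Values $x_1,\ldots,x_n$ are drawn independently, $x_i\sim D_i$, and are presented to the algorithm one at a time, in an arbitrary order that is not known to the algorithm in advance. When a value is observed, the algorithm must irrevocably decide whether or not to choose it. Once a value is chosen the process stops; a value that was observed but not chosen cannot be chosen later. The algorithm succeeds if the value it chooses equals $\max_i x_i$. -}

module Defs where

open import Algebra.Bundles using (CommutativeRing)
import Algebra.Definitions.RawMonoid as RawMonoid
import Algebra.Properties.Semiring.Mult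
open import Data.Bool using (Bool; T)
open import Data.Fin as Fin using (Fin; toℕ)
open import Data.Fin.Permutation using (Permutation′; _⟨$⟩ʳ_)
open import Data.List as List using (List)
open import Data.Nat using (ℕ; suc; NonZero; _!)
open import Data.Product using (Σ-syntax; ∃; ∃-syntax; _×_; _,_)
open import Data.Vec as Vec using (Vec; lookup)
open import Level using (Level; 0ℓ; _⊔_) renaming (suc to lsuc)
open import Relation.Binary.Core using (Rel)
open import Relation.Binary.PropositionalEquality using (_≢_)
open import Relation.Binary.Structures using (IsTotalOrder)
open import Relation.Nullary using (¬_)
open import Relation.Unary using (Pred; _∈_; _≐_; _⊥_; U; ∁; ⋃; Satisfiable)

-- The real numbers, axiomatised as a complete ordered field (unique up to
-- isomorphism).  As is usual for total inverses and suprema, 0# ⁻¹ and the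
-- supremum of an empty or unbounded set are unspecified elements.
record Reals : Set₁ where
  infix 4 _≤_ _<_
  infix 8 _⁻¹
  field
    commutativeRing : CommutativeRing 0ℓ 0ℓ
  open CommutativeRing commutativeRing public renaming (Carrier to ℝ)
  field
    _≤_          : Rel ℝ 0ℓ
    isTotalOrder : IsTotalOrder _≈_ _≤_
    +-monoˡ-≤    : ∀ z {x y} → x ≤ y → x + z ≤ y + z
    *-nonNeg     : ∀ {x y} → 0# ≤ x → 0# ≤ y → 0# ≤ x * y
    0≉1          : ¬ (0# ≈ 1#)
    _⁻¹          : ℝ → ℝ
    ⁻¹-inverseʳ  : ∀ {x} → ¬ (x ≈ 0#) → x * x ⁻¹ ≈ 1#

  _<_ : Rel ℝ 0ℓ
  x < y = x ≤ y × ¬ (x ≈ y)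

  UpperBound : Pred ℝ 0ℓ → Pred ℝ 0ℓ
  UpperBound P b = ∀ {x} → x ∈ P → x ≤ b

  IsSupremum : Pred ℝ 0ℓ → Pred ℝ 0ℓ
  IsSupremum P s = s ∈ UpperBound P × (∀ {b} → b ∈ UpperBound P → s ≤ b)

  field
    sup           : Pred ℝ 0ℓ → ℝ
    sup-supremum  : ∀ {P} → Satisfiable P → Satisfiable (UpperBound P) →
                    IsSupremum P (sup P)

module BestChoice (R : Reals) where
  open Reals R
  open Algebra.Properties.Semiring.Mult semiring using () renaming (_×_ to _ℕ×_)

  ∑ : ∀ {n} → (Fin n → ℝ) → ℝ
  ∑ = RawMonoid.sum +-rawMonoid

  ∏ : ∀ {n} → (Fin n → ℝ) → ℝ
  ∏ = RawMonoid.sum *-rawMonoid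

  fromℕ : ℕ → ℝ
  fromℕ n = n ℕ× 1#

  -- For a series with nonnegative terms, the sum is the supremum of this set.
  PartialSum : (ℕ → ℝ) → Pred ℝ 0ℓ
  PartialSum f x = ∃[ n ] x ≈ ∑ {n} (λ k → f (toℕ k))

  -- e = Σₖ 1/k!
  e : ℝ
  e = sup (PartialSum (λ k → fromℕ (k !) ⁻¹))

  record MeasurableSpace : Set₂ where
    field
      Carrier      : Set
      Measurable   : Pred Carrier 0ℓ → Set₁
      measurable-≐ : ∀ {E F} → E ≐ F → Measurable E → Measurable F
      measurable-U : Measurable U
      measurable-∁ : ∀ {E} → Measurable E → Measurable (∁ E)
      measurable-⋃ : ∀ {E : ℕ → Pred Carrier 0ℓ} →
                     (∀ k → Measurable (E k)) → Measurable (⋃ ℕ E)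

  data Generated {i : Level} {Ω : Set} {I : Set i} (B : I → Pred Ω 0ℓ) :
                 Pred Ω 0ℓ → Set (lsuc 0ℓ ⊔ i) where
    generator : ∀ i → Generated B (B i)
    gen-≐     : ∀ {E F} → E ≐ F → Generated B E → Generated B F
    gen-U     : Generated B U
    gen-∁     : ∀ {E} → Generated B E → Generated B (∁ E)
    gen-⋃     : ∀ {E : ℕ → Pred Ω 0ℓ} →
                (∀ k → Generated B (E k)) → Generated B (⋃ ℕ E)

  Borel : MeasurableSpace
  Borel = record
    { Carrier      = ℝ
    ; Measurable   = Generated {I = ℝ} (λ a x → x ≤ a)
    ; measurable-≐ = gen-≐
    ; measurable-U = gen-U
    ; measurable-∁ = gen-∁
    ; measurable-⋃ = gen-⋃
    }

  record ProbabilityMeasure (M : MeasurableSpace) : Set₁ where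
    open MeasurableSpace M
    field
      prob        : ∀ {E} → Measurable E → ℝ
      prob-cong   : ∀ {E F} → E ≐ F → (m : Measurable E) (m′ : Measurable F) →
                    prob m ≈ prob m′
      prob-nonNeg : ∀ {E} (m : Measurable E) → 0# ≤ prob m
      prob-U      : prob measurable-U ≈ 1#
      prob-⋃      : ∀ {E : ℕ → Pred Carrier 0ℓ} (m : ∀ k → Measurable (E k)) →
                    (∀ j k → j ≢ k → E j ⊥ E k) →
                    IsSupremum (PartialSum (λ k → prob (m k)))
                               (prob (measurable-⋃ m))

  open MeasurableSpace using (Carrier; Measurable)
  open ProbabilityMeasure using (prob)

  record Rectangle (M : MeasurableSpace) (n : ℕ) : Set₁ where
    field
      {base}      : Pred (Carrier M) 0ℓ
      base-meas   : Measurable M base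
      {side}      : Fin n → Pred ℝ 0ℓ
      side-meas   : ∀ i → Measurable Borel (side i)

    ⟦_⟧ : Pred (Carrier M × Vec ℝ n) 0ℓ
    ⟦_⟧ (s , x) = s ∈ base × (∀ i → lookup x i ∈ side i)

  open Rectangle

  -- The product σ-algebra on M × ℝⁿ.
  _⊗ℝ^_ : MeasurableSpace → ℕ → MeasurableSpace
  M ⊗ℝ^ n = record
    { Carrier      = Carrier M × Vec ℝ n
    ; Measurable   = Generated {I = Rectangle M n} ⟦_⟧
    ; measurable-≐ = gen-≐
    ; measurable-U = gen-U
    ; measurable-∁ = gen-∁
    ; measurable-⋃ = gen-⋃
    }

  Distribution : Set₁
  Distribution = ProbabilityMeasure Borel

  Instance : ℕ → Set₁
  Instance n = Fin n → Distribution

  -- P is the product measure μ ⊗ D₁ ⊗ ⋯ ⊗ Dₙ, i.e. the joint law of independent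
  -- draws; it is determined by its values on rectangles.
  IsProduct : ∀ {M n} → ProbabilityMeasure M → Instance n →
              ProbabilityMeasure (M ⊗ℝ^ n) → Set₁
  IsProduct {M} {n} μ D P = ∀ (r : Rectangle M n) →
    prob P (generator r) ≈ prob μ (base-meas r) * ∏ (λ i → prob (D i) (side-meas r i))

  -- A randomised online stopping rule for n values.  Its internal randomness is a
  -- seed drawn, independently of the values, from an arbitrary probability space.
  -- The list consists of the values observed so far, oldest first, each with
  -- the index of the distribution it comes from; the decision is whether to
  -- choose the latest one.
  record Strategy (n : ℕ) : Set₂ where
    field
      space       : MeasurableSpace
      law         : ProbabilityMeasure space
      accept      : Carrier space → List (Fin n × ℝ) → Bool
      accept-meas : ∀ {k} (is : Vec (Fin n) k) →
                    Measurable (space ⊗ℝ^ k)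
                      (λ (s , y) → T (accept s (Vec.toList (Vec.zip is y))))

  -- The strategy may depend on the instance but not on the arrival order.
  -- The case n = 0, in which there is no maximum, is excluded.
  Algorithm : Set₂
  Algorithm = ∀ n → .{{NonZero n}} → Instance n → Strategy n

  module _ {n : ℕ} (A : Strategy n) (σ : Permutation′ n) where
    open Strategy A

    -- σ ⟨$⟩ʳ t is the index of the value arriving at time t.
    observed : Vec ℝ n → Fin n → List (Fin n × ℝ)
    observed x t = List.take (suc (toℕ t))
      (List.tabulate (λ u → σ ⟨$⟩ʳ u , lookup x (σ ⟨$⟩ʳ u)))

    ChoosesAt : Carrier space → Vec ℝ n → Fin n → Set
    ChoosesAt s x t = T (accept s (observed x t)) ×
                      (∀ u → u Fin.< t → ¬ T (accept s (observed x u)))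

    Success : Pred (Carrier space × Vec ℝ n) 0ℓ
    Success (s , x) = ∃[ t ] ChoosesAt s x t ×
                             (∀ i → lookup x i ≤ lookup x (σ ⟨$⟩ʳ t))

    -- The measurability component only gives access to the probability of
    -- Success: it follows from accept-meas and measurability of the
    -- sets { x ∣ xᵢ ≤ xⱼ }.
    SucceedsWithProbability≥ : ℝ → Instance n → Set₁
    SucceedsWithProbability≥ c D =
      Σ[ m ∈ Measurable (space ⊗ℝ^ n) Success ]
        (∀ P → IsProduct law D P → c ≤ prob P m)

module Submission where

open import Defs
import Algebra.Properties.CommutativeMonoid.Sum as Sum
import Algebra.Properties.Ring as RingProperties
import Algebra.Properties.Semiring.Exp as Exp
import Algebra.Properties.Semiring.Mult as Mult
import Algebra.Properties.Semiring.Sum as SemiringSum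
import Algebra.Solver.Ring.NaturalCoefficients.Default as SemiringSolver
open import Axiom.ExcludedMiddle using (ExcludedMiddle)
open import Data.Bool using (Bool; T; if_then_else_)
open import Data.Empty using (⊥-elim)
open import Data.Fin as Fin using (Fin; toℕ)
open import Data.Fin.Permutation as Permutation using (Permutation′)
open import Data.List as List using (List)
open import Data.Nat as ℕ using (ℕ; zero; suc; NonZero; _!)
import Data.Nat.Properties as ℕ
open import Data.Product using (Σ-syntax; ∃-syntax; _×_; _,_; proj₁; proj₂)
open import Data.Sum using (inj₁; inj₂)
open import Data.Unit using (tt)
open import Data.Vec as Vec using (Vec; []; _∷_; lookup)
open import Function using (_∘_; id)
open import Level using (0ℓ)
open import Relation.Binary.Bundles using (Poset)
open import Relation.Binary.PropositionalEquality as ≡ using (_≢_)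
import Relation.Binary.Reasoning.PartialOrder as PartialOrderReasoning
open import Relation.Binary.Structures using (IsTotalOrder)
open import Relation.Nullary using (¬_; yes; no; does)
open import Relation.Nullary.Decidable using (decidable-stable)
open import Relation.Unary using (Pred; _∈_; _⊆_; _∩_; _⊥_; U; ∁; ⋃; Satisfiable; ∅)

-- On a suitable instance the maximum is the last success in a sequence of
-- independent trials.  Let p = 1/(k+1) and q = 1 - p.  The value with index 0
-- is always 0; for 1 ≤ i ≤ k the value with index i is i with probability p
-- and -1 otherwise; the values arrive in the order of their indices.  Write
-- r = p/q = 1/k.  By backward induction, with j ≤ k values to come, a rule
-- that has not stopped picks a maximum that is still to come with probability
-- at most qʲ j r, while a hit just observed is the maximum with probability
-- qʲ ≥ qʲ j r.  So every rule succeeds with probability at most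
-- qᵏ = p qᵏ + qᵏ⁺¹ ≤ p + 1/e; the last step is (1 - h) exp (t + h) ≤ exp t,
-- iterated k+1 times with h = p.  Randomised rules are covered because the
-- induction bounds measures of sets of seeds.

-- Order and arithmetic in an ordered field.

module OrderedField (R : Reals) where
  open Reals R hiding (zero)
  open BestChoice R using (fromℕ)
  open IsTotalOrder isTotalOrder public
    using (total; antisym; isPartialOrder)
    renaming (refl to ≤-refl; trans to ≤-trans; reflexive to ≤-reflexive)
  open RingProperties ring using (-‿distribʳ-*; -‿involutive)

  poset : Poset _ _ _
  poset = record { isPartialOrder = isPartialOrder }

  module ≤-Reasoning = PartialOrderReasoning poset
  module Solver = SemiringSolver commutativeSemiring
  open ≤-Reasoning

  +-monoʳ-≤ : ∀ z {x y} → x ≤ y → z + x ≤ z + y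
  +-monoʳ-≤ z {x} {y} x≤y = begin
    z + x  ≈⟨ +-comm z x ⟩
    x + z  ≤⟨ +-monoˡ-≤ z x≤y ⟩
    y + z  ≈⟨ +-comm y z ⟩
    z + y  ∎

  +-mono-≤ : ∀ {x y u v} → x ≤ y → u ≤ v → x + u ≤ y + v
  +-mono-≤ x≤y u≤v = ≤-trans (+-monoˡ-≤ _ x≤y) (+-monoʳ-≤ _ u≤v)

  x+y-y≈x : ∀ x y → (x + y) - y ≈ x
  x+y-y≈x x y = begin-equality
    (x + y) - y    ≈⟨ +-assoc x y (- y) ⟩
    x + (y - y)    ≈⟨ +-congˡ (-‿inverseʳ y) ⟩
    x + 0#         ≈⟨ +-identityʳ x ⟩
    x              ∎

  x-y+y≈x : ∀ x y → (x - y) + y ≈ x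
  x-y+y≈x x y = begin-equality
    (x - y) + y      ≈⟨ +-assoc x (- y) y ⟩
    x + (- y + y)    ≈⟨ +-congˡ (-‿inverseˡ y) ⟩
    x + 0#           ≈⟨ +-identityʳ x ⟩
    x                ∎

  x+y≤z⇒x≤z-y : ∀ {x y z} → x + y ≤ z → x ≤ z - y
  x+y≤z⇒x≤z-y {x} {y} {z} h = begin
    x            ≈⟨ x+y-y≈x x y ⟨
    (x + y) - y  ≤⟨ +-monoˡ-≤ (- y) h ⟩
    z - y        ∎

  x≤z-y⇒x+y≤z : ∀ {x y z} → x ≤ z - y → x + y ≤ z
  x≤z-y⇒x+y≤z {x} {y} {z} h = begin
    x + y        ≤⟨ +-monoˡ-≤ y h ⟩
    (z - y) + y  ≈⟨ x-y+y≈x z y ⟩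
    z            ∎

  +-cancelʳ-≤ : ∀ z {x y} → x + z ≤ y + z → x ≤ y
  +-cancelʳ-≤ z {x} {y} h = ≤-trans (x+y≤z⇒x≤z-y h) (≤-reflexive (x+y-y≈x y z))

  x≤x+y : ∀ {x y} → 0# ≤ y → x ≤ x + y
  x≤x+y {x} {y} 0≤y = begin
    x       ≈⟨ +-identityʳ x ⟨
    x + 0#  ≤⟨ +-monoʳ-≤ x 0≤y ⟩
    x + y   ∎

  +-nonNeg : ∀ {x y} → 0# ≤ x → 0# ≤ y → 0# ≤ x + y
  +-nonNeg 0≤x 0≤y = ≤-trans 0≤x (x≤x+y 0≤y)

  *-monoʳ-≤ : ∀ {z x y} → 0# ≤ z → x ≤ y → z * x ≤ z * y
  *-monoʳ-≤ {z} {x} {y} 0≤z x≤y = begin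
    z * x                ≈⟨ +-identityˡ (z * x) ⟨
    0# + z * x           ≤⟨ +-monoˡ-≤ (z * x) (*-nonNeg 0≤z 0≤y-x) ⟩
    z * (y - x) + z * x  ≈⟨ distribˡ z (y - x) x ⟨
    z * ((y - x) + x)    ≈⟨ *-congˡ (x-y+y≈x y x) ⟩
    z * y                ∎
    where
    0≤y-x : 0# ≤ y - x
    0≤y-x = x+y≤z⇒x≤z-y (≤-trans (≤-reflexive (+-identityˡ x)) x≤y)

  *-monoˡ-≤ : ∀ {z x y} → 0# ≤ z → x ≤ y → x * z ≤ y * z
  *-monoˡ-≤ {z} {x} {y} 0≤z x≤y = begin
    x * z  ≈⟨ *-comm x z ⟩
    z * x  ≤⟨ *-monoʳ-≤ 0≤z x≤y ⟩
    z * y  ≈⟨ *-comm z y ⟩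
    y * z  ∎

  x≤0⇒0≤-x : ∀ {x} → x ≤ 0# → 0# ≤ - x
  x≤0⇒0≤-x {x} x≤0 = begin
    0#      ≈⟨ -‿inverseʳ x ⟨
    x - x   ≤⟨ +-monoˡ-≤ (- x) x≤0 ⟩
    0# - x  ≈⟨ +-identityˡ (- x) ⟩
    - x     ∎

  0≤1 : 0# ≤ 1#
  0≤1 with total 0# 1#
  ... | inj₁ 0≤1 = 0≤1
  ... | inj₂ 1≤0 = begin
    0#             ≤⟨ *-nonNeg (x≤0⇒0≤-x 1≤0) (x≤0⇒0≤-x 1≤0) ⟩
    - 1# * - 1#    ≈⟨ -‿distribʳ-* (- 1#) 1# ⟨
    - (- 1# * 1#)  ≈⟨ -‿cong (*-identityʳ (- 1#)) ⟩
    - - 1#         ≈⟨ -‿involutive 1# ⟩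
    1#             ∎

  1≰0 : ¬ (1# ≤ 0#)
  1≰0 1≤0 = 0≉1 (antisym 0≤1 1≤0)

  1≤x⇒x≉0 : ∀ {x} → 1# ≤ x → ¬ (x ≈ 0#)
  1≤x⇒x≉0 1≤x x≈0 = 1≰0 (≤-trans 1≤x (≤-reflexive x≈0))

  ⁻¹-nonNeg : ∀ {x} → ¬ (x ≈ 0#) → 0# ≤ x → 0# ≤ x ⁻¹
  ⁻¹-nonNeg {x} x≉0 0≤x with total 0# (x ⁻¹)
  ... | inj₁ h = h
  ... | inj₂ x⁻¹≤0 = ⊥-elim (1≰0 (begin
    1#        ≈⟨ ⁻¹-inverseʳ x≉0 ⟨
    x * x ⁻¹  ≤⟨ *-monoʳ-≤ 0≤x x⁻¹≤0 ⟩
    x * 0#    ≈⟨ zeroʳ x ⟩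
    0#        ∎))

  ⁻¹-unique : ∀ {x y} → x * y ≈ 1# → x ⁻¹ ≈ y
  ⁻¹-unique {x} {y} xy≈1 = begin-equality
    x ⁻¹            ≈⟨ *-identityʳ (x ⁻¹) ⟨
    x ⁻¹ * 1#       ≈⟨ *-congˡ xy≈1 ⟨
    x ⁻¹ * (x * y)  ≈⟨ solve 3 (λ a b c → a :* (b :* c) := (b :* a) :* c) refl (x ⁻¹) x y ⟩
    x * x ⁻¹ * y    ≈⟨ *-congʳ (⁻¹-inverseʳ x≉0) ⟩
    1# * y          ≈⟨ *-identityˡ y ⟩
    y               ∎
    where
    open Solver
    x≉0 : ¬ (x ≈ 0#)
    x≉0 x≈0 = 0≉1 (trans (sym (trans (*-congʳ x≈0) (zeroˡ y))) xy≈1)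

  *-cancelˡ-⁻¹ : ∀ {z} → ¬ (z ≈ 0#) → ∀ x → z ⁻¹ * (z * x) ≈ x
  *-cancelˡ-⁻¹ {z} z≉0 x = begin-equality
    z ⁻¹ * (z * x)  ≈⟨ solve 3 (λ a b c → a :* (b :* c) := (b :* a) :* c) refl (z ⁻¹) z x ⟩
    z * z ⁻¹ * x    ≈⟨ *-congʳ (⁻¹-inverseʳ z≉0) ⟩
    1# * x          ≈⟨ *-identityˡ x ⟩
    x               ∎
    where open Solver

  z*x≤y⇒x≤z⁻¹*y : ∀ {z x y} → ¬ (z ≈ 0#) → 0# ≤ z → z * x ≤ y → x ≤ z ⁻¹ * y
  z*x≤y⇒x≤z⁻¹*y {z} {x} {y} z≉0 0≤z zx≤y = begin
    x               ≈⟨ *-cancelˡ-⁻¹ z≉0 x ⟨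
    z ⁻¹ * (z * x)  ≤⟨ *-monoʳ-≤ (⁻¹-nonNeg z≉0 0≤z) zx≤y ⟩
    z ⁻¹ * y        ∎

  x≤z⁻¹*y⇒z*x≤y : ∀ {z x y} → ¬ (z ≈ 0#) → 0# ≤ z → x ≤ z ⁻¹ * y → z * x ≤ y
  x≤z⁻¹*y⇒z*x≤y {z} {x} {y} z≉0 0≤z x≤z⁻¹y = begin
    z * x           ≤⟨ *-monoʳ-≤ 0≤z x≤z⁻¹y ⟩
    z * (z ⁻¹ * y)  ≈⟨ solve 3 (λ a b c → b :* (a :* c) := a :* (b :* c)) refl (z ⁻¹) z y ⟩
    z ⁻¹ * (z * y)  ≈⟨ *-cancelˡ-⁻¹ z≉0 y ⟩
    y               ∎
    where open Solver

  fromℕ-nonNeg : ∀ n → 0# ≤ fromℕ n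
  fromℕ-nonNeg zero    = ≤-refl
  fromℕ-nonNeg (suc n) = +-nonNeg 0≤1 (fromℕ-nonNeg n)

  fromℕ-mono-≤ : ∀ {m n} → m ℕ.≤ n → fromℕ m ≤ fromℕ n
  fromℕ-mono-≤ {n = n} ℕ.z≤n = fromℕ-nonNeg n
  fromℕ-mono-≤ (ℕ.s≤s m≤n)   = +-monoʳ-≤ 1# (fromℕ-mono-≤ m≤n)

  fromℕ-cancel-≤ : ∀ {m n} → fromℕ m ≤ fromℕ n → m ℕ.≤ n
  fromℕ-cancel-≤ {zero} _ = ℕ.z≤n
  fromℕ-cancel-≤ {suc m} {zero} h = ⊥-elim (1≰0 (≤-trans (x≤x+y (fromℕ-nonNeg m)) h))
  fromℕ-cancel-≤ {suc m} {suc n} h =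
    ℕ.s≤s (fromℕ-cancel-≤ (+-cancelʳ-≤ 1# (begin
      fromℕ m + 1#  ≈⟨ +-comm (fromℕ m) 1# ⟩
      1# + fromℕ m  ≤⟨ h ⟩
      1# + fromℕ n  ≈⟨ +-comm 1# (fromℕ n) ⟩
      fromℕ n + 1#  ∎)))

  fromℕ-suc≉0 : ∀ n → ¬ (fromℕ (suc n) ≈ 0#)
  fromℕ-suc≉0 n = 1≤x⇒x≉0 (x≤x+y (fromℕ-nonNeg n))

-- Suprema, the Archimedean property and partial sums of series.

module Suprema (em : ExcludedMiddle 0ℓ) (R : Reals) where
  open Reals R hiding (zero)
  open BestChoice R using (∑; fromℕ; PartialSum)
  open OrderedField R
  open Sum +-commutativeMonoid using (∑-distrib-+; sum-cong-≋)
  open SemiringSum semiring using (*-distribˡ-sum)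
  open ≤-Reasoning

  sup-unique : ∀ {P s t} → IsSupremum P s → IsSupremum P t → s ≈ t
  sup-unique (ubₛ , lubₛ) (ubₜ , lubₜ) = antisym (lubₛ ubₜ) (lubₜ ubₛ)

  -- For `c` nonzero, dividing by `c` reduces the claim to leastness of `s`. For `c ≈ 0#` what
  -- remains is `0# ≤ b`, which any single element of `P` provides; this is where nonemptiness
  -- enters.
  scaled-sup-≤ : ∀ {P s c b} → Satisfiable P → IsSupremum P s → 0# ≤ c →
                 (∀ {x} → x ∈ P → c * x ≤ b) → c * s ≤ b
  scaled-sup-≤ {P} {s} {c} {b} (x , x∈P) (_ , lub) 0≤c ub with em {P = c ≈ 0#}
  ... | no c≉0 = x≤z⁻¹*y⇒z*x≤y c≉0 0≤c
    (lub (λ y∈P → z*x≤y⇒x≤z⁻¹*y c≉0 0≤c (ub y∈P)))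
  ... | yes c≈0 = begin
    c * s  ≈⟨ trans (*-congʳ c≈0) (zeroˡ s) ⟩
    0#     ≈⟨ trans (*-congʳ c≈0) (zeroˡ x) ⟨
    c * x  ≤⟨ ub x∈P ⟩
    b      ∎

  -- The classical supremum argument: if `s` is the supremum of the multiples of `x`, then `s - x`
  -- is again an upper bound, because adding `x` to a multiple gives the next one. Hence
  -- `s ≤ s - x`.
  archimedean : ∀ {x b} → (∀ n → fromℕ n * x ≤ b) → x ≤ 0#
  archimedean {x} {b} bounded = +-cancelʳ-≤ s (begin
    x + s        ≤⟨ +-monoʳ-≤ x (proj₂ s-sup λ { (n , y≈nx) → ≤-trans (≤-reflexive y≈nx) (n*x≤s-x n) }) ⟩
    x + (s - x)  ≈⟨ +-comm x (s - x) ⟩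
    (s - x) + x  ≈⟨ x-y+y≈x s x ⟩
    s            ≈⟨ +-identityˡ s ⟨
    0# + s       ∎)
    where
    Multiple : Pred ℝ 0ℓ
    Multiple y = ∃[ n ] y ≈ fromℕ n * x
    s = sup Multiple
    s-sup : IsSupremum Multiple s
    s-sup = sup-supremum (_ , 0 , refl)
      (b , λ { (n , y≈nx) → ≤-trans (≤-reflexive y≈nx) (bounded n) })
    n*x≤s-x : ∀ n → fromℕ n * x ≤ s - x
    n*x≤s-x n = x+y≤z⇒x≤z-y (proj₁ s-sup (suc n , (begin-equality
      fromℕ n * x + x       ≈⟨ +-comm _ x ⟩
      x + fromℕ n * x       ≈⟨ +-congʳ (*-identityˡ x) ⟨
      1# * x + fromℕ n * x  ≈⟨ distribʳ x 1# (fromℕ n) ⟨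
      (1# + fromℕ n) * x    ∎)))

  partial : (ℕ → ℝ) → ℕ → ℝ
  partial f n = ∑ {n} (λ k → f (toℕ k))

  partial-zero : ∀ {f} → (∀ k → f k ≈ 0#) → ∀ n → partial f n ≈ 0#
  partial-zero f≈0 zero    = refl
  partial-zero f≈0 (suc n) = trans (+-cong (f≈0 0) (partial-zero (λ k → f≈0 (suc k)) n)) (+-identityˡ 0#)

  partial-cong : ∀ {f g} → (∀ k → f k ≈ g k) → ∀ n → partial f n ≈ partial g n
  partial-cong f≈g n = sum-cong-≋ {n} (λ k → f≈g (toℕ k))

  partial-mono-≤ : ∀ {f g} → (∀ k → f k ≤ g k) → ∀ n → partial f n ≤ partial g n
  partial-mono-≤ f≤g zero    = ≤-refl
  partial-mono-≤ f≤g (suc n) = +-mono-≤ (f≤g 0) (partial-mono-≤ (λ k → f≤g (suc k)) n)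

  partial-nonNeg : ∀ {f} → (∀ k → 0# ≤ f k) → ∀ n → 0# ≤ partial f n
  partial-nonNeg f≥0 zero    = ≤-refl
  partial-nonNeg f≥0 (suc n) = +-nonNeg (f≥0 0) (partial-nonNeg (λ k → f≥0 (suc k)) n)

  partial-mono : ∀ {f m n} → (∀ k → 0# ≤ f k) → m ℕ.≤ n → partial f m ≤ partial f n
  partial-mono {n = n} f≥0 ℕ.z≤n = partial-nonNeg f≥0 n
  partial-mono f≥0 (ℕ.s≤s m≤n)   = +-monoʳ-≤ _ (partial-mono (λ k → f≥0 (suc k)) m≤n)

  partial-linear : ∀ p q f g n →
    partial (λ k → p * f k + q * g k) n ≈ p * partial f n + q * partial g n
  partial-linear p q f g n = begin-equality
    ∑ {n} (λ k → p * f (toℕ k) + q * g (toℕ k))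
      ≈⟨ ∑-distrib-+ {n} (λ k → p * f (toℕ k)) (λ k → q * g (toℕ k)) ⟩
    ∑ {n} (λ k → p * f (toℕ k)) + ∑ {n} (λ k → q * g (toℕ k))
      ≈⟨ +-cong (*-distribˡ-sum {n} p (λ k → f (toℕ k))) (*-distribˡ-sum {n} q (λ k → g (toℕ k))) ⟨
    p * partial f n + q * partial g n  ∎

  -- Monotonicity lets the two partial sums be truncated independently.
  partial-sup-linear : ∀ {p q f g a b} → 0# ≤ p → 0# ≤ q →
    (∀ k → 0# ≤ f k) → (∀ k → 0# ≤ g k) →
    IsSupremum (PartialSum f) a → IsSupremum (PartialSum g) b →
    IsSupremum (PartialSum (λ k → p * f k + q * g k)) (p * a + q * b)
  partial-sup-linear {p} {q} {f} {g} {a} {b} 0≤p 0≤q f≥0 g≥0 fa gb = upper , least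
    where
    upper : p * a + q * b ∈ UpperBound (PartialSum (λ k → p * f k + q * g k))
    upper {x} (n , x≈) = begin
      x                                  ≈⟨ x≈ ⟩
      partial (λ k → p * f k + q * g k) n ≈⟨ partial-linear p q f g n ⟩
      p * partial f n + q * partial g n  ≤⟨ +-mono-≤ (*-monoʳ-≤ 0≤p (proj₁ fa (n , refl)))
                                                     (*-monoʳ-≤ 0≤q (proj₁ gb (n , refl))) ⟩
      p * a + q * b                      ∎
    least : ∀ {c} → c ∈ UpperBound (PartialSum (λ k → p * f k + q * g k)) → p * a + q * b ≤ c
    least {c} ub = x≤z-y⇒x+y≤z (scaled-sup-≤ (_ , 0 , refl) fa 0≤p λ { {x} (m , x≈) →
      x+y≤z⇒x≤z-y (begin
        p * x + q * b  ≈⟨ +-comm _ _ ⟩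
        q * b + p * x  ≤⟨ x≤z-y⇒x+y≤z (scaled-sup-≤ (_ , 0 , refl) gb 0≤q λ { {y} (n , y≈) →
                            x+y≤z⇒x≤z-y (bound m n x≈ y≈) }) ⟩
        c              ∎) })
      where
      bound : ∀ m n {x y} → x ≈ partial f m → y ≈ partial g n → q * y + p * x ≤ c
      bound m n {x} {y} x≈ y≈ = begin
        q * y + p * x                      ≈⟨ +-comm _ _ ⟩
        p * x + q * y                      ≈⟨ +-cong (*-congˡ x≈) (*-congˡ y≈) ⟩
        p * partial f m + q * partial g n
          ≤⟨ +-mono-≤ (*-monoʳ-≤ 0≤p (partial-mono f≥0 (ℕ.m≤m⊔n m n)))
                      (*-monoʳ-≤ 0≤q (partial-mono g≥0 (ℕ.m≤n⊔m m n))) ⟩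
        p * partial f (m ℕ.⊔ n) + q * partial g (m ℕ.⊔ n)
          ≈⟨ partial-linear p q f g (m ℕ.⊔ n) ⟨
        partial (λ k → p * f k + q * g k) (m ℕ.⊔ n)
          ≤⟨ ub (m ℕ.⊔ n , refl) ⟩
        c ∎

-- The truncated exponential series and the comparison of powers of 1 - p with 1/e.

module Exponential (em : ExcludedMiddle 0ℓ) (R : Reals) where
  open Reals R hiding (zero)
  open BestChoice R using (fromℕ; PartialSum; e)
  open OrderedField R
  open Suprema em R
  open Exp semiring using (_^_)
  open Mult semiring using (×1-homo-*)
  open ≤-Reasoning

  -- term t k = tᵏ / k!
  term : ℝ → ℕ → ℝ
  term t zero    = 1#
  term t (suc k) = fromℕ (suc k) ⁻¹ * (t * term t k)

  suc*term : ∀ t k → fromℕ (suc k) * term t (suc k) ≈ t * term t k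
  suc*term t k = begin-equality
    fromℕ (suc k) * (fromℕ (suc k) ⁻¹ * (t * term t k))  ≈⟨ *-assoc _ _ _ ⟨
    fromℕ (suc k) * fromℕ (suc k) ⁻¹ * (t * term t k)    ≈⟨ *-congʳ (⁻¹-inverseʳ (fromℕ-suc≉0 k)) ⟩
    1# * (t * term t k)                                  ≈⟨ *-identityˡ _ ⟩
    t * term t k                                         ∎

  term-cong : ∀ {s t} → s ≈ t → ∀ k → term s k ≈ term t k
  term-cong s≈t zero    = refl
  term-cong s≈t (suc k) = *-congˡ (*-cong s≈t (term-cong s≈t k))

  term-nonNeg : ∀ {t} → 0# ≤ t → ∀ k → 0# ≤ term t k
  term-nonNeg 0≤t zero    = 0≤1
  term-nonNeg 0≤t (suc k) = *-nonNeg (⁻¹-nonNeg (fromℕ-suc≉0 k) (fromℕ-nonNeg (suc k)))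
                                     (*-nonNeg 0≤t (term-nonNeg 0≤t k))

  term-at-1 : ∀ k → fromℕ (k !) * term 1# k ≈ 1#
  term-at-1 zero    = trans (*-identityʳ _) (+-identityʳ 1#)
  term-at-1 (suc k) = begin-equality
    fromℕ (suc k ℕ.* k !) * term 1# (suc k)        ≈⟨ *-congʳ (×1-homo-* (suc k) (k !)) ⟩
    fromℕ (suc k) * fromℕ (k !) * term 1# (suc k)
      ≈⟨ solve 3 (λ a b c → a :* b :* c := b :* (a :* c)) refl (fromℕ (suc k)) (fromℕ (k !)) (term 1# (suc k)) ⟩
    fromℕ (k !) * (fromℕ (suc k) * term 1# (suc k)) ≈⟨ *-congˡ (suc*term 1# k) ⟩
    fromℕ (k !) * (1# * term 1# k)                 ≈⟨ *-congˡ (*-identityˡ _) ⟩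
    fromℕ (k !) * term 1# k                        ≈⟨ term-at-1 k ⟩
    1#                                             ∎
    where open Solver

  module _ {t h : ℝ} (0≤t : 0# ≤ t) (0≤h : 0# ≤ h) where
    open Solver

    0≤t+h : 0# ≤ t + h
    0≤t+h = +-nonNeg 0≤t 0≤h

    -- (t+h)ᵏ⁺¹ - tᵏ⁺¹ ≤ (k+1) h (t+h)ᵏ, divided by (k+1)!.
    term-increment : ∀ k → term (t + h) (suc k) ≤ term t (suc k) + h * term (t + h) k
    term-increment k = begin
      term (t + h) (suc k)
        ≤⟨ z*x≤y⇒x≤z⁻¹*y (fromℕ-suc≉0 k) (fromℕ-nonNeg (suc k)) scaled ⟩
      fromℕ (suc k) ⁻¹ * (t * term t k + fromℕ (suc k) * (h * term (t + h) k))
        ≈⟨ distribˡ _ _ _ ⟩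
      term t (suc k) + fromℕ (suc k) ⁻¹ * (fromℕ (suc k) * (h * term (t + h) k))
        ≈⟨ +-congˡ (*-cancelˡ-⁻¹ (fromℕ-suc≉0 k) _) ⟩
      term t (suc k) + h * term (t + h) k ∎
      where
      -- This bound and `term-increment` are proved by a joint induction: the case `suc j` calls
      -- `term-increment` at `j`. A factor `t` is then enlarged to `t + h`, so that `suc*term` turns
      -- the product into a multiple of the next term.
      shifted : ∀ k → t * term (t + h) k ≤ t * term t k + fromℕ k * (h * term (t + h) k)
      shifted zero    = x≤x+y (*-nonNeg ≤-refl (*-nonNeg 0≤h 0≤1))
      shifted (suc j) = begin
        t * term (t + h) (suc j)
          ≤⟨ *-monoʳ-≤ 0≤t (term-increment j) ⟩
        t * (term t (suc j) + h * term (t + h) j)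
          ≈⟨ solve 4 (λ t a h b → t :* (a :+ h :* b) := t :* a :+ t :* (h :* b)) refl t (term t (suc j)) h (term (t + h) j) ⟩
        t * term t (suc j) + t * (h * term (t + h) j)
          ≤⟨ +-monoʳ-≤ _ (*-monoˡ-≤ (*-nonNeg 0≤h (term-nonNeg 0≤t+h j)) (x≤x+y 0≤h)) ⟩
        t * term t (suc j) + (t + h) * (h * term (t + h) j)
          ≈⟨ +-congˡ (solve 3 (λ u h b → u :* (h :* b) := h :* (u :* b)) refl (t + h) h (term (t + h) j)) ⟩
        t * term t (suc j) + h * ((t + h) * term (t + h) j)
          ≈⟨ +-congˡ (*-congˡ (suc*term (t + h) j)) ⟨
        t * term t (suc j) + h * (fromℕ (suc j) * term (t + h) (suc j))
          ≈⟨ +-congˡ (solve 3 (λ h n b → h :* (n :* b) := n :* (h :* b)) refl h (fromℕ (suc j)) (term (t + h) (suc j))) ⟩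
        t * term t (suc j) + fromℕ (suc j) * (h * term (t + h) (suc j)) ∎
      scaled : fromℕ (suc k) * term (t + h) (suc k) ≤ t * term t k + fromℕ (suc k) * (h * term (t + h) k)
      scaled = begin
        fromℕ (suc k) * term (t + h) (suc k)
          ≈⟨ suc*term (t + h) k ⟩
        (t + h) * term (t + h) k
          ≈⟨ distribʳ _ t h ⟩
        t * term (t + h) k + h * term (t + h) k
          ≤⟨ +-monoˡ-≤ _ (shifted k) ⟩
        t * term t k + fromℕ k * (h * term (t + h) k) + h * term (t + h) k
          ≈⟨ solve 3 (λ a n x → a :+ n :* x :+ x := a :+ (x :+ n :* x)) refl (t * term t k) (fromℕ k) (h * term (t + h) k) ⟩
        t * term t k + (h * term (t + h) k + fromℕ k * (h * term (t + h) k))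
          ≈⟨ +-congˡ (+-congʳ (*-identityˡ _)) ⟨
        t * term t k + (1# * (h * term (t + h) k) + fromℕ k * (h * term (t + h) k))
          ≈⟨ +-congˡ (distribʳ _ 1# (fromℕ k)) ⟨
        t * term t k + fromℕ (suc k) * (h * term (t + h) k) ∎

    -- The truncated form of exp (t + h) ≤ exp t + h exp (t + h), obtained by summing
    -- `term-increment`. The constant term is split off, which leaves a sum of length `K` on the
    -- right; nonnegativity of the terms allows lengthening it to `suc K`.
    partial-increment : ∀ K → partial (term (t + h)) K ≤ partial (term t) K + h * partial (term (t + h)) K
    partial-increment zero    = x≤x+y (*-nonNeg 0≤h ≤-refl)
    partial-increment (suc K) = begin
      1# + partial (λ k → term (t + h) (suc k)) K
        ≤⟨ +-monoʳ-≤ 1# (partial-mono-≤ increment K) ⟩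
      1# + partial (λ k → 1# * term t (suc k) + h * term (t + h) k) K
        ≈⟨ +-congˡ (partial-linear 1# h (λ k → term t (suc k)) (term (t + h)) K) ⟩
      1# + (1# * partial (λ k → term t (suc k)) K + h * partial (term (t + h)) K)
        ≈⟨ +-congˡ (+-congʳ (*-identityˡ _)) ⟩
      1# + (partial (λ k → term t (suc k)) K + h * partial (term (t + h)) K)
        ≈⟨ +-assoc _ _ _ ⟨
      partial (term t) (suc K) + h * partial (term (t + h)) K
        ≤⟨ +-monoʳ-≤ _ (*-monoʳ-≤ 0≤h (partial-mono (term-nonNeg 0≤t+h) (ℕ.n≤1+n K))) ⟩
      partial (term t) (suc K) + h * partial (term (t + h)) (suc K) ∎
      where
      increment : ∀ k → term (t + h) (suc k) ≤ 1# * term t (suc k) + h * term (t + h) k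
      increment k = ≤-trans (term-increment k) (≤-reflexive (+-congʳ (sym (*-identityˡ _))))

  partial-term-0 : ∀ K → partial (term 0#) K ≤ 1#
  partial-term-0 zero    = 0≤1
  partial-term-0 (suc K) = ≤-reflexive (trans
    (+-congˡ (partial-zero {λ k → term 0# (suc k)} (λ k → trans (*-congˡ (zeroˡ _)) (zeroʳ _)) K)) (+-identityʳ 1#))

  module _ {p q : ℝ} (0≤p : 0# ≤ p) (0≤q : 0# ≤ q) (p+q≈1 : p + q ≈ 1#) where

    q^n-nonNeg : ∀ n → 0# ≤ q ^ n
    q^n-nonNeg zero    = 0≤1
    q^n-nonNeg (suc n) = *-nonNeg 0≤q (q^n-nonNeg n)

    q^n-≤1 : ∀ n → q ^ n ≤ 1#
    q^n-≤1 zero    = ≤-refl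
    q^n-≤1 (suc n) = begin
      q * q ^ n  ≤⟨ *-monoʳ-≤ 0≤q (q^n-≤1 n) ⟩
      q * 1#     ≈⟨ *-identityʳ q ⟩
      q          ≤⟨ x≤x+y 0≤p ⟩
      q + p      ≈⟨ +-comm q p ⟩
      p + q      ≈⟨ p+q≈1 ⟩
      1#         ∎

    -- Adding `p * E` to both sides turns the left side into `E`, and the claim into
    -- `partial-increment` with increment `p`.
    q*partial-term : ∀ {t} → 0# ≤ t → ∀ K → q * partial (term (t + p)) K ≤ partial (term t) K
    q*partial-term {t} 0≤t K = +-cancelʳ-≤ (p * E) (begin
      q * E + p * E            ≈⟨ trans (+-comm _ _) (sym (distribʳ E p q)) ⟩
      (p + q) * E              ≈⟨ trans (*-congʳ p+q≈1) (*-identityˡ E) ⟩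
      E                        ≤⟨ partial-increment 0≤t 0≤p K ⟩
      partial (term t) K + p * E  ∎)
      where E = partial (term (t + p)) K

    -- The n-fold iterate of (1 - p) exp (t + p) ≤ exp t, i.e. (1 - p)ⁿ exp (n p) ≤ 1.
    q^n*partial-term : ∀ n K → q ^ n * partial (term (fromℕ n * p)) K ≤ 1#
    q^n*partial-term zero K = begin
      1# * partial (term (0# * p)) K  ≈⟨ *-identityˡ _ ⟩
      partial (term (0# * p)) K       ≈⟨ partial-cong (term-cong (zeroˡ p)) K ⟩
      partial (term 0#) K             ≤⟨ partial-term-0 K ⟩
      1#                              ∎
    q^n*partial-term (suc n) K = begin
      q * q ^ n * partial (term (fromℕ (suc n) * p)) K
        ≈⟨ *-congˡ (partial-cong (term-cong suc*p) K) ⟩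
      q * q ^ n * partial (term (fromℕ n * p + p)) K
        ≈⟨ solve 3 (λ a b c → a :* b :* c := b :* (a :* c)) refl q (q ^ n) _ ⟩
      q ^ n * (q * partial (term (fromℕ n * p + p)) K)
        ≤⟨ *-monoʳ-≤ (q^n-nonNeg n) (q*partial-term (*-nonNeg (fromℕ-nonNeg n) 0≤p) K) ⟩
      q ^ n * partial (term (fromℕ n * p)) K
        ≤⟨ q^n*partial-term n K ⟩
      1# ∎
      where
      open Solver
      suc*p : fromℕ (suc n) * p ≈ fromℕ n * p + p
      suc*p = trans (distribʳ p 1# (fromℕ n)) (trans (+-congʳ (*-identityˡ p)) (+-comm p _))

    -- With `n p = 1` the series is evaluated at 1, where its terms are the inverse factorials that
    -- define `e`.
    q^n*partial-e : ∀ n → fromℕ n * p ≈ 1# →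
      ∀ {x} → x ∈ PartialSum (λ k → fromℕ (k !) ⁻¹) → q ^ n * x ≤ 1#
    q^n*partial-e n np≈1 {x} (K , x≈) = begin
      q ^ n * x                                  ≈⟨ *-congˡ x≈ ⟩
      q ^ n * partial (λ k → fromℕ (k !) ⁻¹) K   ≈⟨ *-congˡ (partial-cong (λ k → ⁻¹-unique (term-at-1 k)) K) ⟩
      q ^ n * partial (term 1#) K                ≈⟨ *-congˡ (partial-cong (term-cong np≈1) K) ⟨
      q ^ n * partial (term (fromℕ n * p)) K     ≤⟨ q^n*partial-term n K ⟩
      1#                                         ∎

  -- `sup` is specified only for nonempty bounded sets, so the partial sums first need an upper
  -- bound. The case p = q = 1/2, n = 2 of `q^n*partial-e` shows that a quarter of each partial sum
  -- is at most 1.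
  e-supremum : IsSupremum (PartialSum (λ k → fromℕ (k !) ⁻¹)) e
  e-supremum = sup-supremum (_ , 0 , refl) ((½ ^ 2) ⁻¹ * 1# , λ x∈ →
    z*x≤y⇒x≤z⁻¹*y ½²≉0 (q^n-nonNeg 0≤½ 0≤½ ½+½≈1 2) (q^n*partial-e 0≤½ 0≤½ ½+½≈1 2 2*½≈1 x∈))
    where
    ½ = fromℕ 2 ⁻¹
    0≤½ : 0# ≤ ½
    0≤½ = ⁻¹-nonNeg (fromℕ-suc≉0 1) (fromℕ-nonNeg 2)
    2*½≈1 : fromℕ 2 * ½ ≈ 1#
    2*½≈1 = ⁻¹-inverseʳ (fromℕ-suc≉0 1)
    ½+½≈1 : ½ + ½ ≈ 1#
    ½+½≈1 = begin-equality
      ½ + ½                  ≈⟨ +-cong (*-identityˡ ½) (*-identityˡ ½) ⟨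
      1# * ½ + 1# * ½        ≈⟨ distribʳ ½ 1# 1# ⟨
      (1# + 1#) * ½          ≈⟨ *-congʳ (+-congˡ (+-identityʳ 1#)) ⟨
      (1# + (1# + 0#)) * ½   ≈⟨ 2*½≈1 ⟩
      1#                     ∎
    ½²≉0 : ¬ (½ ^ 2 ≈ 0#)
    ½²≉0 ½²≈0 = 0≉1 (begin-equality
      0#                                      ≈⟨ zeroʳ _ ⟨
      fromℕ 2 * fromℕ 2 * 0#                  ≈⟨ *-congˡ ½²≈0 ⟨
      fromℕ 2 * fromℕ 2 * (½ * (½ * 1#))
        ≈⟨ solve 3 (λ a b c → a :* a :* (b :* (b :* c)) := a :* b :* (a :* b) :* c) refl (fromℕ 2) ½ 1# ⟩
      fromℕ 2 * ½ * (fromℕ 2 * ½) * 1#        ≈⟨ *-congʳ (*-cong 2*½≈1 2*½≈1) ⟩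
      1# * 1# * 1#                            ≈⟨ trans (*-identityʳ _) (*-identityˡ 1#) ⟩
      1#                                      ∎)
      where open Solver

  1≤e : 1# ≤ e
  1≤e = begin
    1#                    ≈⟨ ⁻¹-unique (term-at-1 0) ⟨
    fromℕ (0 !) ⁻¹        ≈⟨ +-identityʳ _ ⟨
    fromℕ (0 !) ⁻¹ + 0#   ≤⟨ proj₁ e-supremum (1 , refl) ⟩
    e                     ∎

  -- The uniform bound on `q ^ n` times a partial sum of the series passes to the supremum, giving
  -- `q ^ n * e ≤ 1#`; then divide by `e`, which is nonzero by `1≤e`.
  q^n≤e⁻¹ : ∀ {p q} → 0# ≤ p → 0# ≤ q → p + q ≈ 1# → ∀ n → fromℕ n * p ≈ 1# → q ^ n ≤ e ⁻¹
  q^n≤e⁻¹ {p} {q} 0≤p 0≤q p+q≈1 n np≈1 = begin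
    q ^ n      ≤⟨ z*x≤y⇒x≤z⁻¹*y (1≤x⇒x≉0 1≤e) (≤-trans 0≤1 1≤e) (begin
      e * q ^ n  ≈⟨ *-comm e (q ^ n) ⟩
      q ^ n * e  ≤⟨ scaled-sup-≤ (_ , 0 , refl) e-supremum (q^n-nonNeg 0≤p 0≤q p+q≈1 n)
                      (q^n*partial-e 0≤p 0≤q p+q≈1 n np≈1) ⟩
      1#         ∎) ⟩
    e ⁻¹ * 1#  ≈⟨ *-identityʳ _ ⟩
    e ⁻¹       ∎

-- Elementary consequences of countable additivity.

module MeasureProperties (em : ExcludedMiddle 0ℓ) (R : Reals) where
  open Reals R hiding (zero)
  open BestChoice R
  open OrderedField R
  open Suprema em R
  open ≤-Reasoning

  module _ (M : MeasurableSpace) where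
    open MeasurableSpace M

    measurable-∅ : Measurable ∅
    measurable-∅ = measurable-≐ ((λ ¬u → ¬u tt) , λ ()) (measurable-∁ measurable-U)

    measurable-∩ : ∀ {E F} → Measurable E → Measurable F → Measurable (E ∩ F)
    measurable-∩ {E} {F} mE mF = measurable-≐ (to , from) (measurable-∁ (measurable-⋃ {G} mG))
      where
      G : ℕ → Pred Carrier 0ℓ
      G zero    = ∁ E
      G (suc _) = ∁ F
      mG : ∀ k → Measurable (G k)
      mG zero    = measurable-∁ mE
      mG (suc _) = measurable-∁ mF
      to : ∁ (⋃ ℕ G) ⊆ E ∩ F
      to ¬∪ = decidable-stable em (λ x∉E → ¬∪ (0 , x∉E)) , decidable-stable em (λ x∉F → ¬∪ (1 , x∉F))
      from : E ∩ F ⊆ ∁ (⋃ ℕ G)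
      from (x∈E , _) (zero , x∉E)  = x∉E x∈E
      from (_ , x∈F) (suc _ , x∉F) = x∉F x∈F

  module _ {M : MeasurableSpace} (μ : ProbabilityMeasure M) where
    open MeasurableSpace M
    open ProbabilityMeasure μ

    -- Countable additivity for the constant sequence `∅` bounds every multiple of `c` by one fixed
    -- probability, so the Archimedean property forces `c ≤ 0#`.
    prob-∅ : prob (measurable-∅ M) ≈ 0#
    prob-∅ = antisym (archimedean (λ n → begin
      fromℕ n * c                  ≈⟨ n*c≈partial n ⟩
      partial (λ _ → c) n          ≤⟨ proj₁ (prob-⋃ {λ _ → ∅} (λ _ → measurable-∅ M) (λ _ _ _ ())) (n , refl) ⟩
      prob (measurable-⋃ {λ _ → ∅} (λ _ → measurable-∅ M)) ∎)) (prob-nonNeg _)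
      where
      c = prob (measurable-∅ M)
      n*c≈partial : ∀ n → fromℕ n * c ≈ partial (λ _ → c) n
      n*c≈partial zero    = zeroˡ c
      n*c≈partial (suc n) = trans (distribʳ c 1# (fromℕ n)) (+-cong (*-identityˡ c) (n*c≈partial n))

    prob-empty : ∀ {E} (m : Measurable E) → (∀ {x} → ¬ (x ∈ E)) → prob m ≈ 0#
    prob-empty m E-empty = trans (prob-cong ((λ x∈E → ⊥-elim (E-empty x∈E)) , λ ()) m (measurable-∅ M)) prob-∅

    -- Finite additivity comes from countable additivity by padding the two pieces with empty sets:
    -- the partial sums are constant from length 2 on, so their supremum is the sum of the two
    -- probabilities.
    prob-split : ∀ {E A} (mE : Measurable E) (mA : Measurable A) →
      prob mE ≈ prob (measurable-∩ M mE mA) + prob (measurable-∩ M mE (measurable-∁ mA))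
    prob-split {E} {A} mE mA = trans (prob-cong (to , from) mE (measurable-⋃ mG))
      (sup-unique (prob-⋃ mG disjoint) (upper , least))
      where
      G : ℕ → Pred Carrier 0ℓ
      G 0             = E ∩ A
      G 1             = E ∩ ∁ A
      G (suc (suc _)) = ∅
      mG : ∀ k → Measurable (G k)
      mG 0             = measurable-∩ M mE mA
      mG 1             = measurable-∩ M mE (measurable-∁ mA)
      mG (suc (suc _)) = measurable-∅ M
      to : E ⊆ ⋃ ℕ G
      to {x} x∈E with em {P = x ∈ A}
      ... | yes x∈A = 0 , x∈E , x∈A
      ... | no x∉A  = 1 , x∈E , x∉A
      from : ⋃ ℕ G ⊆ E
      from (0 , x∈E , _) = x∈E
      from (1 , x∈E , _) = x∈E
      disjoint : ∀ j k → j ≢ k → G j ⊥ G k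
      disjoint 0 0 j≢k _ = j≢k ≡.refl
      disjoint 0 1 _ ((_ , x∈A) , (_ , x∉A)) = x∉A x∈A
      disjoint 0 (suc (suc _)) _ (_ , ())
      disjoint 1 0 _ ((_ , x∉A) , (_ , x∈A)) = x∉A x∈A
      disjoint 1 1 j≢k _ = j≢k ≡.refl
      disjoint 1 (suc (suc _)) _ (_ , ())
      disjoint (suc (suc _)) _ _ (() , _)
      f : ℕ → ℝ
      f k = prob (mG k)
      f-nonNeg : ∀ k → 0# ≤ f k
      f-nonNeg k = prob-nonNeg (mG k)
      total≈ : ∀ n → partial f (2 ℕ.+ n) ≈ f 0 + f 1
      total≈ n = +-congˡ (trans (+-congˡ (partial-zero {λ k → f (2 ℕ.+ k)} (λ _ → prob-∅) n)) (+-identityʳ _))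
      upper : f 0 + f 1 ∈ UpperBound (PartialSum f)
      upper {x} (n , x≈) = begin
        x                    ≈⟨ x≈ ⟩
        partial f n          ≤⟨ partial-mono f-nonNeg (ℕ.m≤n+m n 2) ⟩
        partial f (2 ℕ.+ n)  ≈⟨ total≈ n ⟩
        f 0 + f 1            ∎
      least : ∀ {b} → b ∈ UpperBound (PartialSum f) → f 0 + f 1 ≤ b
      least ub = ub (2 , sym (total≈ 0))

    prob-mono : ∀ {E F} (mE : Measurable E) (mF : Measurable F) → E ⊆ F → prob mE ≤ prob mF
    prob-mono {E} {F} mE mF E⊆F = begin
      prob mE                                          ≈⟨ prob-cong ((λ x∈E → E⊆F x∈E , x∈E) , proj₂) mE (measurable-∩ M mF mE) ⟩
      prob (measurable-∩ M mF mE)                      ≤⟨ x≤x+y (prob-nonNeg _) ⟩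
      prob (measurable-∩ M mF mE) + prob (measurable-∩ M mF (measurable-∁ mE)) ≈⟨ prob-split mF mE ⟨
      prob mF                                          ∎

  -- Point masses, two-point laws and explicit product measures.

  indicator : Set → ℝ
  indicator P = if does (em {P = P}) then 1# else 0#

  indicator-yes : ∀ {P} → P → indicator P ≈ 1#
  indicator-yes {P} p with em {P = P}
  ... | yes _ = refl
  ... | no ¬p = ⊥-elim (¬p p)

  indicator-no : ∀ {P} → ¬ P → indicator P ≈ 0#
  indicator-no {P} ¬p with em {P = P}
  ... | yes p = ⊥-elim (¬p p)
  ... | no _  = refl

  indicator-nonNeg : ∀ P → 0# ≤ indicator P
  indicator-nonNeg P with em {P = P}
  ... | yes _ = 0≤1
  ... | no _  = ≤-refl

  indicator-cong : ∀ {P Q} → (P → Q) → (Q → P) → indicator P ≈ indicator Q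
  indicator-cong {P} {Q} P⇒Q Q⇒P with em {P = P}
  ... | yes p = sym (indicator-yes (P⇒Q p))
  ... | no ¬p = sym (indicator-no (λ q → ¬p (Q⇒P q)))

  indicator-× : ∀ {P Q} → indicator (P × Q) ≈ indicator P * indicator Q
  indicator-× {P} {Q} with em {P = P}
  ... | yes p = trans (indicator-cong proj₂ (p ,_)) (sym (*-identityˡ _))
  ... | no ¬p = trans (indicator-no (λ (p , _) → ¬p p)) (sym (zeroˡ _))

  -- At most one `P k` holds, so partial sums never exceed 1, and they reach 1 as soon as a valid
  -- index is included. This is countable additivity of a point mass.
  indicator-⋃ : ∀ {P : ℕ → Set} → (∀ j k → j ≢ k → ¬ (P j × P k)) →
    IsSupremum (PartialSum (λ k → indicator (P k))) (indicator (Σ[ k ∈ ℕ ] P k))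
  indicator-⋃ {P} disjoint = (λ { {x} (n , x≈) → ≤-trans (≤-reflexive x≈) (upper P disjoint n) }) , least
    where
    upper : ∀ P → (∀ j k → j ≢ k → ¬ (P j × P k)) → ∀ n →
            partial (λ k → indicator (P k)) n ≤ indicator (Σ[ k ∈ ℕ ] P k)
    upper P disjoint zero = indicator-nonNeg _
    upper P disjoint (suc n) with em {P = P 0}
    ... | yes p = begin
      indicator (P 0) + partial (λ k → indicator (P (suc k))) n
        ≈⟨ +-cong (indicator-yes p) (partial-zero {λ k → indicator (P (suc k))}
             (λ k → indicator-no (λ p′ → disjoint 0 (suc k) (λ ()) (p , p′))) n) ⟩
      1# + 0#                     ≈⟨ +-identityʳ 1# ⟩
      1#                          ≈⟨ indicator-yes (0 , p) ⟨
      indicator (Σ[ k ∈ ℕ ] P k)  ∎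
    ... | no ¬p = begin
      indicator (P 0) + partial (λ k → indicator (P (suc k))) n
        ≈⟨ trans (+-congʳ (indicator-no ¬p)) (+-identityˡ _) ⟩
      partial (λ k → indicator (P (suc k))) n
        ≤⟨ upper (λ k → P (suc k)) (λ j k j≢k → disjoint (suc j) (suc k) (λ { ≡.refl → j≢k ≡.refl })) n ⟩
      indicator (Σ[ k ∈ ℕ ] P (suc k))
        ≈⟨ indicator-cong (λ (k , p) → suc k , p) (λ { (zero , p) → ⊥-elim (¬p p) ; (suc k , p) → k , p }) ⟩
      indicator (Σ[ k ∈ ℕ ] P k) ∎
    term≤partial : ∀ P k → indicator (P k) ≤ partial (λ k → indicator (P k)) (suc k)
    term≤partial P zero    = ≤-reflexive (sym (+-identityʳ _))
    term≤partial P (suc k) = begin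
      indicator (P (suc k))                                     ≤⟨ term≤partial (λ k → P (suc k)) k ⟩
      partial (λ k → indicator (P (suc k))) (suc k)             ≤⟨ x≤x+y (indicator-nonNeg (P 0)) ⟩
      partial (λ k → indicator (P (suc k))) (suc k) + indicator (P 0)  ≈⟨ +-comm _ _ ⟩
      partial (λ k → indicator (P k)) (suc (suc k))             ∎
    least : ∀ {b} → b ∈ UpperBound (PartialSum (λ k → indicator (P k))) → indicator (Σ[ k ∈ ℕ ] P k) ≤ b
    least {b} ub with em {P = Σ[ k ∈ ℕ ] P k}
    ... | no _        = ub (0 , refl)
    ... | yes (k , p) = begin
      1#                                           ≈⟨ indicator-yes p ⟨
      indicator (P k)                              ≤⟨ term≤partial P k ⟩
      partial (λ k → indicator (P k)) (suc k)      ≤⟨ ub (suc k , refl) ⟩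
      b                                            ∎

  dirac : ℝ → Distribution
  dirac a = record
    { prob        = λ {E} _ → indicator (a ∈ E)
    ; prob-cong   = λ (E⊆F , F⊆E) _ _ → indicator-cong E⊆F F⊆E
    ; prob-nonNeg = λ _ → indicator-nonNeg _
    ; prob-U      = indicator-yes tt
    ; prob-⋃      = λ _ disjoint → indicator-⋃ (λ j k j≢k → disjoint j k j≢k)
    }

  -- The two values may coincide, so a deterministic value is also represented this way.
  record TwoPoint : Set where
    field
      {p q}    : ℝ
      0≤p      : 0# ≤ p
      0≤q      : 0# ≤ q
      p+q≈1    : p + q ≈ 1#
      hit miss : ℝ

    expect : (ℝ → ℝ) → ℝ
    expect f = p * f hit + q * f miss

    expect-mono : ∀ {f g} → f hit ≤ g hit → f miss ≤ g miss → expect f ≤ expect g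
    expect-mono h m = +-mono-≤ (*-monoʳ-≤ 0≤p h) (*-monoʳ-≤ 0≤q m)

    expect-const : ∀ {x} → p * x + q * x ≈ x
    expect-const {x} = trans (sym (distribʳ x p q)) (trans (*-congʳ p+q≈1) (*-identityˡ x))

    -- Averaging over a kernel serves twice: with point masses it gives the two-point law itself,
    -- and applied repeatedly it adjoins independent coordinates in `joint`.
    mixture : ∀ {M} → (ℝ → ProbabilityMeasure M) → ProbabilityMeasure M
    mixture κ = record
      { prob        = λ m → expect (λ a → prob (κ a) m)
      ; prob-cong   = λ E≐F m m′ → +-cong (*-congˡ (prob-cong (κ hit) E≐F m m′)) (*-congˡ (prob-cong (κ miss) E≐F m m′))
      ; prob-nonNeg = λ m → +-nonNeg (*-nonNeg 0≤p (prob-nonNeg (κ hit) m)) (*-nonNeg 0≤q (prob-nonNeg (κ miss) m))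
      ; prob-U      = trans (+-cong (*-congˡ (prob-U (κ hit))) (*-congˡ (prob-U (κ miss)))) expect-const
      ; prob-⋃      = λ m disjoint → partial-sup-linear 0≤p 0≤q
                        (λ k → prob-nonNeg (κ hit) (m k)) (λ k → prob-nonNeg (κ miss) (m k))
                        (prob-⋃ (κ hit) m disjoint) (prob-⋃ (κ miss) m disjoint)
      }
      where open ProbabilityMeasure

    distribution : Distribution
    distribution = mixture dirac

  open TwoPoint using (expect; mixture; distribution)

  𝔼 : ∀ {n} → (Fin n → TwoPoint) → (Vec ℝ n → ℝ) → ℝ
  𝔼 {zero}  d f = f []
  𝔼 {suc n} d f = expect (d Fin.zero) (λ a → 𝔼 (d ∘ Fin.suc) (λ v → f (a ∷ v)))

  𝔼-cong : ∀ {n} (d : Fin n → TwoPoint) {f g} → (∀ v → f v ≈ g v) → 𝔼 d f ≈ 𝔼 d g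
  𝔼-cong {zero}  d f≈g = f≈g []
  𝔼-cong {suc n} d f≈g = +-cong
    (*-congˡ (𝔼-cong (d ∘ Fin.suc) (λ v → f≈g (_ ∷ v)))) (*-congˡ (𝔼-cong (d ∘ Fin.suc) (λ v → f≈g (_ ∷ v))))

  𝔼-+ : ∀ {n} (d : Fin n → TwoPoint) f g → 𝔼 d (λ v → f v + g v) ≈ 𝔼 d f + 𝔼 d g
  𝔼-+ {zero}  d f g = refl
  𝔼-+ {suc n} d f g = trans
    (+-cong (*-congˡ (𝔼-+ (d ∘ Fin.suc) _ _)) (*-congˡ (𝔼-+ (d ∘ Fin.suc) _ _)))
    (solve 6 (λ p q a b a′ b′ → p :* (a :+ b) :+ q :* (a′ :+ b′) := (p :* a :+ q :* a′) :+ (p :* b :+ q :* b′)) refl _ _ _ _ _ _)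
    where open Solver

  𝔼-≤ : ∀ {n} (d : Fin n → TwoPoint) {f c} → (∀ v → f v ≤ c) → 𝔼 d f ≤ c
  𝔼-≤ {zero}  d f≤c = f≤c []
  𝔼-≤ {suc n} d {f} {c} f≤c = ≤-trans
    (expect-mono {λ a → 𝔼 (d ∘ Fin.suc) (λ v → f (a ∷ v))} {λ _ → c}
      (𝔼-≤ (d ∘ Fin.suc) (λ v → f≤c (hit ∷ v))) (𝔼-≤ (d ∘ Fin.suc) (λ v → f≤c (miss ∷ v))))
    (≤-reflexive expect-const)
    where open TwoPoint (d Fin.zero)

  joint : ∀ {M n} → (Fin n → TwoPoint) → (Vec ℝ n → ProbabilityMeasure M) → ProbabilityMeasure M
  joint {n = zero}  d κ = κ []
  joint {n = suc n} d κ = mixture (d Fin.zero) (λ a → joint (d ∘ Fin.suc) (λ v → κ (a ∷ v)))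

  prob-joint : ∀ {M n} (d : Fin n → TwoPoint) (κ : Vec ℝ n → ProbabilityMeasure M)
    {E} (m : MeasurableSpace.Measurable M E) →
    ProbabilityMeasure.prob (joint d κ) m ≈ 𝔼 d (λ v → ProbabilityMeasure.prob (κ v) m)
  prob-joint {n = zero}  d κ m = refl
  prob-joint {n = suc n} d κ m =
    +-cong (*-congˡ (prob-joint (d ∘ Fin.suc) _ m)) (*-congˡ (prob-joint (d ∘ Fin.suc) _ m))

  module _ {M : MeasurableSpace} {n : ℕ} where
    open MeasurableSpace using (Measurable; Carrier)
    open MeasurableSpace M using (measurable-≐; measurable-U; measurable-∁; measurable-⋃)
    open Rectangle

    -- Taking sections commutes with complements and countable unions, so only rectangles matter.
    -- The section of a rectangle is its base or empty, according to whether `v` lies in all the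
    -- sides.
    section-measurable : ∀ {E} (v : Vec ℝ n) → Measurable (M ⊗ℝ^ n) E → Measurable M (λ s → E (s , v))
    section-measurable v (generator r) with em {P = ∀ i → lookup v i ∈ side r i}
    ... | yes v∈r = measurable-≐ ((λ s∈ → s∈ , v∈r) , proj₁) (base-meas r)
    ... | no  v∉r = measurable-≐ ((λ ()) , (λ (_ , v∈r) → ⊥-elim (v∉r v∈r))) (measurable-∅ M)
    section-measurable v (gen-≐ (E⊆F , F⊆E) m) = measurable-≐ (E⊆F , F⊆E) (section-measurable v m)
    section-measurable v gen-U     = measurable-U
    section-measurable v (gen-∁ m) = measurable-∁ (section-measurable v m)
    section-measurable v (gen-⋃ m) = measurable-⋃ (λ k → section-measurable v (m k))

    module _ (μ : ProbabilityMeasure M) where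
      open ProbabilityMeasure

      -- The product of `μ` with the point mass at `v`.
      atPoint : Vec ℝ n → ProbabilityMeasure (M ⊗ℝ^ n)
      atPoint v = record
        { prob        = λ m → prob μ (section-measurable v m)
        ; prob-cong   = λ (E⊆F , F⊆E) m m′ → prob-cong μ (E⊆F , F⊆E) (section-measurable v m) (section-measurable v m′)
        ; prob-nonNeg = λ m → prob-nonNeg μ (section-measurable v m)
        ; prob-U      = prob-U μ
        ; prob-⋃      = λ m disjoint → prob-⋃ μ (λ k → section-measurable v (m k)) (λ j k j≢k → disjoint j k j≢k)
        }

      prob-section : ∀ (r : Rectangle M n) v →
        prob (atPoint v) (generator r) ≈ prob μ (base-meas r) * indicator (∀ i → lookup v i ∈ side r i)
      prob-section r v with em {P = ∀ i → lookup v i ∈ side r i}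
      ... | yes v∈r = trans (prob-cong μ (proj₁ , (_, v∈r)) _ (base-meas r)) (sym (*-identityʳ _))
      ... | no v∉r  = trans (prob-empty μ _ (λ (_ , v∈r) → v∉r v∈r)) (sym (zeroʳ _))

  -- Induction on the number of coordinates; the free constant `c` absorbs the indicator of the
  -- first coordinate before the recursive call.
  𝔼-rectangle : ∀ {n} (d : Fin n → TwoPoint) (S : Fin n → Pred ℝ 0ℓ) c →
    𝔼 d (λ v → c * indicator (∀ i → lookup v i ∈ S i)) ≈
    c * ∏ (λ i → expect (d i) (λ a → indicator (a ∈ S i)))
  𝔼-rectangle {zero}  d S c = *-congˡ (indicator-yes (λ ()))
  𝔼-rectangle {suc n} d S c = trans (+-cong (*-congˡ (inner _)) (*-congˡ (inner _)))
    (solve 6 (λ p q c h m w → p :* ((c :* h) :* w) :+ q :* ((c :* m) :* w) := c :* ((p :* h :+ q :* m) :* w)) refl _ _ c _ _ _)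
    where
    open Solver
    inner : ∀ a → 𝔼 (d ∘ Fin.suc) (λ v → c * indicator (∀ i → lookup (a ∷ v) i ∈ S i)) ≈
      (c * indicator (a ∈ S Fin.zero)) * ∏ (λ i → expect (d (Fin.suc i)) (λ a → indicator (a ∈ S (Fin.suc i))))
    inner a = trans
      (𝔼-cong (d ∘ Fin.suc) (λ v → trans
        (*-congˡ (trans (indicator-cong {Q = a ∈ S Fin.zero × (∀ i → lookup v i ∈ S (Fin.suc i))}
                  (λ h → h Fin.zero , h ∘ Fin.suc) (λ { (h , _) Fin.zero → h ; (_ , h) (Fin.suc i) → h i }))
                        indicator-×))
        (sym (*-assoc c _ _))))
      (𝔼-rectangle (d ∘ Fin.suc) (S ∘ Fin.suc) (c * indicator (a ∈ S Fin.zero)))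

  -- A success guarantee speaks only about measures satisfying `IsProduct`. This exhibits one whose
  -- probabilities are finite weighted sums of seed probabilities.
  joint-isProduct : ∀ {M n} (μ : ProbabilityMeasure M) (d : Fin n → TwoPoint) →
    IsProduct μ (distribution ∘ d) (joint d (atPoint μ))
  joint-isProduct μ d r = begin-equality
    prob (joint d (atPoint μ)) (generator r)         ≈⟨ prob-joint d (atPoint μ) (generator r) ⟩
    𝔼 d (λ v → prob (atPoint μ v) (generator r))     ≈⟨ 𝔼-cong d (prob-section μ r) ⟩
    𝔼 d (λ v → prob μ (base-meas r) * indicator (∀ i → lookup v i ∈ side r i))
      ≈⟨ 𝔼-rectangle d (λ i → side r i) (prob μ (base-meas r)) ⟩
    prob μ (base-meas r) * ∏ (λ i → prob (distribution (d i)) (side-meas r i)) ∎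
    where
    open ProbabilityMeasure using (prob)
    open Rectangle

-- Stopping at the last success of a sequence of independent trials.

module LastHit (em : ExcludedMiddle 0ℓ) (R : Reals) where
  open Reals R hiding (zero)
  open BestChoice R
  open OrderedField R
  open Exp semiring using (_^_)
  open Suprema em R
  open Exponential em R
  open MeasureProperties em R
  open ≤-Reasoning
  open MeasurableSpace using (Carrier; Measurable; measurable-U; measurable-∁)
  open ProbabilityMeasure using (prob)

  0≰-1 : ¬ (0# ≤ - 1#)
  0≰-1 0≤-1 = 1≰0 (begin
    1#          ≈⟨ +-identityˡ 1# ⟨
    0# + 1#     ≤⟨ +-monoˡ-≤ 1# 0≤-1 ⟩
    - 1# + 1#   ≈⟨ -‿inverseˡ 1# ⟩
    0#          ∎)

  module _ {I : Set} where

    -- An arbitrary labelling `ι` in place of a permutation keeps the notion closed under removing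
    -- the first observation. For the identity permutation and `ι = id` it agrees with `observed`.
    observe : ∀ {k} → (Fin k → I) → Vec ℝ k → Fin k → List (I × ℝ)
    observe ι v t = List.take (suc (toℕ t)) (List.tabulate (λ u → ι u , lookup v u))

    -- The threshold 0 excludes the choice of a missed value, which is -1.
    Wins : ∀ {k} → (List (I × ℝ) → Bool) → (Fin k → I) → Vec ℝ k → Set
    Wins accept ι v = ∃[ t ]
      (T (accept (observe ι v t)) × (∀ u → u Fin.< t → ¬ T (accept (observe ι v u)))) ×
      (∀ i → lookup v i ≤ lookup v t) × 0# ≤ lookup v t

    -- Prefixing the first observation to the history turns the rule into a rule for the remaining
    -- values. The negated conjunction covers both uses at once: a first value that is rejected, and
    -- a first value that is a miss.
    wins-later : ∀ {k} accept (ι : Fin (suc k) → I) a v →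
      ¬ (T (accept List.[ ι Fin.zero , a ]) × 0# ≤ a × (∀ i → lookup v i ≤ a)) →
      Wins accept ι (a ∷ v) → Wins (accept ∘ ((ι Fin.zero , a) List.∷_)) (ι ∘ Fin.suc) v
    wins-later accept ι a v ¬now (Fin.zero , (acc , _) , max , 0≤) =
      ⊥-elim (¬now (acc , 0≤ , max ∘ Fin.suc))
    wins-later accept ι a v ¬now (Fin.suc t , (acc , first) , max , 0≤) =
      t , (acc , λ u u<t → first (Fin.suc u) (ℕ.s≤s u<t)) , max ∘ Fin.suc , 0≤

    -- Acceptance of the first value rules out any later choice, so a win must be with `a`, which is
    -- then a maximum.
    wins-now : ∀ {k} accept (ι : Fin (suc k) → I) a v →
      T (accept List.[ ι Fin.zero , a ]) → Wins accept ι (a ∷ v) → ∀ i → lookup v i ≤ a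
    wins-now accept ι a v acc (Fin.zero , _ , max , _) = max ∘ Fin.suc
    wins-now accept ι a v acc (Fin.suc t , (_ , first) , _) = ⊥-elim (first Fin.zero (ℕ.s≤s ℕ.z≤n) acc)

  module _ {p q r : ℝ} (0≤p : 0# ≤ p) (0≤q : 0# ≤ q) (0≤r : 0# ≤ r)
           (p+q≈1 : p + q ≈ 1#) (q*r≈p : q * r ≈ p) where

    hitOrMiss : ℝ → TwoPoint
    hitOrMiss h = record { 0≤p = 0≤p ; 0≤q = 0≤q ; p+q≈1 = p+q≈1 ; hit = h ; miss = - 1# }

    -- Every hit exceeds `a`, so `f` can be positive only on the branch on which all values are
    -- misses. That branch has weight `q ^ k`.
    𝔼-all-miss : ∀ {k a c} (hit : Fin k → ℝ) {f} → (∀ i → ¬ (hit i ≤ a)) → (∀ v → f v ≤ c) →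
      (∀ v → ¬ (∀ i → lookup v i ≤ a) → f v ≤ 0#) → 𝔼 (hitOrMiss ∘ hit) f ≤ q ^ k * c
    𝔼-all-miss {zero} {a} {c} hit {f} _ f≤c _ = ≤-trans (f≤c []) (≤-reflexive (sym (*-identityˡ c)))
    𝔼-all-miss {suc k} {a} {c} hit {f} hit≰a f≤c f≤0 = begin
      p * 𝔼 d′ (λ v → f (hit Fin.zero ∷ v)) + q * 𝔼 d′ (λ v → f (- 1# ∷ v))
        ≤⟨ +-mono-≤
             (*-monoʳ-≤ 0≤p (𝔼-≤ d′ (λ v → f≤0 (hit Fin.zero ∷ v) (λ all → hit≰a Fin.zero (all Fin.zero)))))
             (*-monoʳ-≤ 0≤q (𝔼-all-miss (hit ∘ Fin.suc) (hit≰a ∘ Fin.suc) (λ v → f≤c (- 1# ∷ v))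
               (λ v ¬all → f≤0 (- 1# ∷ v) (λ all → ¬all (all ∘ Fin.suc))))) ⟩
      p * 0# + q * (q ^ k * c)  ≈⟨ trans (+-congʳ (zeroʳ p)) (+-identityˡ _) ⟩
      q * (q ^ k * c)           ≈⟨ *-assoc q (q ^ k) c ⟨
      q ^ suc k * c             ∎
      where d′ = hitOrMiss ∘ hit ∘ Fin.suc

    k*r≤1 : ∀ {k} → fromℕ (suc k) * r ≤ 1# → fromℕ k * r ≤ 1#
    k*r≤1 {k} = ≤-trans (*-monoˡ-≤ 0≤r (fromℕ-mono-≤ (ℕ.n≤1+n k)))

    module _ {I : Set} {M : MeasurableSpace} (μ : ProbabilityMeasure M) where

      -- Measurability with the observed values frozen: the values are summed over explicitly, and
      -- events of seeds are all that is measured.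
      AcceptMeasurable : (Carrier M → List (I × ℝ) → Bool) → Set₁
      AcceptMeasurable accept = ∀ {j} (is : Vec I j) (y : Vec ℝ j) →
        Measurable M (λ s → T (accept s (Vec.toList (Vec.zip is y))))

      tail-measurable : ∀ accept i a → AcceptMeasurable accept →
        AcceptMeasurable (λ s → accept s ∘ ((i , a) List.∷_))
      tail-measurable accept i a m is y = m (i ∷ is) (a ∷ y)

      -- Here `a` has just been observed and all later hits exceed it. The seeds are split by
      -- whether they accept `a`: those that do win only if everything later misses, and the others
      -- are handled by `prob-wins`. Each part is bounded by `q ^ k` times its share of `B`. Asking
      -- `E v` only to lie among the winning seeds in `B` lets it be any measurable such set, in
      -- particular its intersection with either part.
      prob-wins-after-hit : ∀ {k} (ι : Fin (suc k) → I) {a} (hit : Fin k → ℝ) →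
        (∀ i → ¬ (hit i ≤ a)) → (∀ {i j} → i Fin.< j → ¬ (hit j ≤ hit i)) → fromℕ k * r ≤ 1# →
        ∀ accept → AcceptMeasurable accept →
        ∀ {B} (mB : Measurable M B) {E : Vec ℝ k → Pred (Carrier M) 0ℓ} (mE : ∀ v → Measurable M (E v)) →
        (∀ v → E v ⊆ B) → (∀ v {s} → s ∈ E v → Wins (accept s) ι (a ∷ v)) →
        𝔼 (hitOrMiss ∘ hit) (λ v → prob μ (mE v)) ≤ q ^ k * prob μ mB

      -- B is the event that nothing has been accepted before.
      prob-wins : ∀ {k} (ι : Fin k → I) (hit : Fin k → ℝ) →
        (∀ {i j} → i Fin.< j → ¬ (hit j ≤ hit i)) → fromℕ k * r ≤ 1# →
        ∀ accept → AcceptMeasurable accept →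
        ∀ {B} (mB : Measurable M B) {E : Vec ℝ k → Pred (Carrier M) 0ℓ} (mE : ∀ v → Measurable M (E v)) →
        (∀ v → E v ⊆ B) → (∀ v {s} → s ∈ E v → Wins (accept s) ι v) →
        𝔼 (hitOrMiss ∘ hit) (λ v → prob μ (mE v)) ≤ q ^ k * (fromℕ k * r) * prob μ mB

      prob-wins-after-hit {k} ι {a} hit hit≰a increasing kr≤1 accept m {B} mB {E} mE E⊆B wins = begin
        𝔼 d (λ v → prob μ (mE v))
          ≈⟨ 𝔼-cong d (λ v → prob-split μ (mE v) mA) ⟩
        𝔼 d (λ v → prob μ (mE∩A v) + prob μ (mE∖A v))
          ≈⟨ 𝔼-+ d _ _ ⟩
        𝔼 d (λ v → prob μ (mE∩A v)) + 𝔼 d (λ v → prob μ (mE∖A v))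
          ≤⟨ +-mono-≤ accepted rejected ⟩
        q ^ k * prob μ mB∩A + q ^ k * prob μ mB∖A
          ≈⟨ distribˡ _ _ _ ⟨
        q ^ k * (prob μ mB∩A + prob μ mB∖A)
          ≈⟨ *-congˡ (prob-split μ mB mA) ⟨
        q ^ k * prob μ mB ∎
        where
        d = hitOrMiss ∘ hit
        i₀ = ι Fin.zero
        A : Pred (Carrier M) 0ℓ
        A s = T (accept s List.[ i₀ , a ])
        mA : Measurable M A
        mA = m (i₀ ∷ []) (a ∷ [])
        mE∩A = λ v → measurable-∩ M (mE v) mA
        mE∖A = λ v → measurable-∩ M (mE v) (measurable-∁ M mA)
        mB∩A = measurable-∩ M mB mA
        mB∖A = measurable-∩ M mB (measurable-∁ M mA)
        accepted : 𝔼 d (λ v → prob μ (mE∩A v)) ≤ q ^ k * prob μ mB∩A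
        accepted = 𝔼-all-miss hit hit≰a
          (λ v → prob-mono μ (mE∩A v) mB∩A (λ (s∈E , s∈A) → E⊆B v s∈E , s∈A))
          (λ v ¬all → ≤-reflexive (prob-empty μ (mE∩A v)
            (λ {s} (s∈E , s∈A) → ¬all (wins-now (accept s) ι a v s∈A (wins v s∈E)))))
        rejected : 𝔼 d (λ v → prob μ (mE∖A v)) ≤ q ^ k * prob μ mB∖A
        rejected = begin
          𝔼 d (λ v → prob μ (mE∖A v))
            ≤⟨ prob-wins (ι ∘ Fin.suc) hit increasing kr≤1
                 (λ s → accept s ∘ ((i₀ , a) List.∷_)) (tail-measurable accept i₀ a m) mB∖A mE∖A
                 (λ v (s∈E , s∉A) → E⊆B v s∈E , s∉A)
                 (λ v {s} (s∈E , s∉A) → wins-later (accept s) ι a v (λ (s∈A , _) → s∉A s∈A) (wins v s∈E)) ⟩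
          q ^ k * (fromℕ k * r) * prob μ mB∖A
            -- The condition `fromℕ k * r ≤ 1#` says that the bound for going on does not exceed the
            -- bound for stopping at `a`.
            ≤⟨ *-monoˡ-≤ (ProbabilityMeasure.prob-nonNeg μ _) (*-monoʳ-≤ (q^n-nonNeg 0≤p 0≤q p+q≈1 k) kr≤1) ⟩
          q ^ k * 1# * prob μ mB∖A
            ≈⟨ *-congʳ (*-identityʳ _) ⟩
          q ^ k * prob μ mB∖A ∎

      prob-wins {zero} ι hit _ _ accept m mB mE _ wins = begin
        prob μ (mE [])              ≈⟨ prob-empty μ (mE []) (λ {s} s∈E → no-time (accept s) (wins [] s∈E)) ⟩
        0#                          ≈⟨ zeroˡ _ ⟨
        0# * prob μ mB              ≈⟨ *-congʳ (trans (*-identityˡ _) (zeroˡ r)) ⟨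
        1# * (0# * r) * prob μ mB   ∎
        where
        no-time : ∀ accept → ¬ Wins accept ι []
        no-time accept (() , _)
      prob-wins {suc k} ι hit increasing kr≤1 accept m {B} mB {E} mE E⊆B wins = begin
        p * 𝔼 d′ (λ v → prob μ (mE (h ∷ v))) + q * 𝔼 d′ (λ v → prob μ (mE (- 1# ∷ v)))
          ≤⟨ +-mono-≤ (*-monoʳ-≤ 0≤p onHit) (*-monoʳ-≤ 0≤q onMiss) ⟩
        p * (q ^ k * b) + q * (q ^ k * (fromℕ k * r) * b)
          -- Writing the hit weight `p` as `q * r` gives both branches the factor `q * q ^ k`; their
          -- coefficients `r` and `fromℕ k * r` then add up to `fromℕ (suc k) * r`.
          ≈⟨ +-congʳ (*-congʳ q*r≈p) ⟨
        q * r * (q ^ k * b) + q * (q ^ k * (fromℕ k * r) * b)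
          ≈⟨ solve 5 (λ q r w b n → q :* r :* (w :* b) :+ q :* (w :* (n :* r) :* b)
                                 := q :* w :* (r :+ n :* r) :* b) refl q r (q ^ k) b (fromℕ k) ⟩
        q * q ^ k * (r + fromℕ k * r) * b
          ≈⟨ *-congʳ (*-congˡ (trans (distribʳ r 1# (fromℕ k)) (+-congʳ (*-identityˡ r)))) ⟨
        q * q ^ k * (fromℕ (suc k) * r) * b ∎
        where
        open Solver
        h = hit Fin.zero
        d′ = hitOrMiss ∘ hit ∘ Fin.suc
        b = prob μ mB
        onHit : 𝔼 d′ (λ v → prob μ (mE (h ∷ v))) ≤ q ^ k * b
        onHit = prob-wins-after-hit ι (hit ∘ Fin.suc) (λ i → increasing (ℕ.s≤s ℕ.z≤n))
          (λ i<j → increasing (ℕ.s≤s i<j)) (k*r≤1 {k} kr≤1) accept m mB (λ v → mE (h ∷ v))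
          (λ v → E⊆B (h ∷ v)) (λ v → wins (h ∷ v))
        onMiss : 𝔼 d′ (λ v → prob μ (mE (- 1# ∷ v))) ≤ q ^ k * (fromℕ k * r) * b
        -- A miss fails the threshold in `Wins`, so no split by acceptance is made. Seeds accepting
        -- this miss stay in `B`, which can only enlarge the upper bound.
        onMiss = prob-wins (ι ∘ Fin.suc) (hit ∘ Fin.suc)
          (λ i<j → increasing (ℕ.s≤s i<j)) (k*r≤1 {k} kr≤1)
          (λ s → accept s ∘ ((ι Fin.zero , - 1#) List.∷_)) (tail-measurable accept (ι Fin.zero) (- 1#) m)
          mB (λ v → mE (- 1# ∷ v))
          (λ v → E⊆B (- 1# ∷ v))
          (λ v {s} s∈E → wins-later (accept s) ι (- 1#) v (λ (_ , 0≤-1 , _) → 0≰-1 0≤-1) (wins (- 1# ∷ v) s∈E))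

    sure : ℝ → TwoPoint
    sure a = record { 0≤p = 0≤1 ; 0≤q = ≤-refl ; p+q≈1 = +-identityʳ 1# ; hit = a ; miss = a }

    -- The sure 0 forces the maximum to be at least 0, so a successful choice is never a miss, even
    -- when all trials fail.
    hardInstance : ∀ {k} → Fin (suc k) → TwoPoint
    hardInstance Fin.zero    = sure 0#
    hardInstance (Fin.suc i) = hitOrMiss (fromℕ (suc (toℕ i)))

    success≤q^k : ∀ {k c} → fromℕ k * r ≤ 1# → (A : Strategy (suc k)) →
      SucceedsWithProbability≥ A Permutation.id c (TwoPoint.distribution ∘ hardInstance) → c ≤ q ^ k
    success≤q^k {k} {c} kr≤1 A (m , success) = begin
      c                                  ≤⟨ success (joint d (atPoint law)) (joint-isProduct law d) ⟩
      prob (joint d (atPoint law)) m     ≈⟨ prob-joint d (atPoint law) m ⟩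
      -- The sure value is a two-point law with weights 1 and 0, so the second branch vanishes.
      1# * 𝔼 d′ (λ v → prob law (section-measurable (0# ∷ v) m)) + 0# * _
        ≈⟨ trans (+-cong (*-identityˡ _) (zeroˡ _)) (+-identityʳ _) ⟩
      𝔼 d′ (λ v → prob law (section-measurable (0# ∷ v) m))
        -- The sure 0 takes the place of a hit just observed: it lies below all later hits, and
        -- before it nothing has been accepted, so `B` is the whole seed space.
        ≤⟨ prob-wins-after-hit law id hit
             (λ i h → 1≰0 (≤-trans (x≤x+y (fromℕ-nonNeg (toℕ i))) h))
             (λ i<j h → ℕ.<⇒≱ (ℕ.s≤s i<j) (fromℕ-cancel-≤ h))
             kr≤1 accept (λ is y → section-measurable y (accept-meas is)) (measurable-U space)
             (λ v → section-measurable (0# ∷ v) m) (λ _ _ → tt)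
             -- `max Fin.zero` compares the chosen value with the sure 0 and so yields the threshold
             -- required by `Wins`.
             (λ v (t , chooses , max) → t , chooses , max , max Fin.zero) ⟩
      q ^ k * prob law (measurable-U space)  ≈⟨ *-congˡ (ProbabilityMeasure.prob-U law) ⟩
      q ^ k * 1#                             ≈⟨ *-identityʳ _ ⟩
      q ^ k                                  ∎
      where
      open Strategy A
      d = hardInstance
      hit : Fin k → ℝ
      hit i = fromℕ (suc (toℕ i))
      d′ = hitOrMiss ∘ hit

-- Choice of parameters and the limit of long instances.

theorem2 : ExcludedMiddle 0ℓ →
    (R : Reals) →
    let open Reals R
        open BestChoice R
    in (ε : ℝ) → 0# < ε →
       ¬ (Σ[ A ∈ Algorithm ]
            ((n : ℕ) .{{_ : NonZero n}} (D : Instance n) (σ : Permutation′ n) →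
               SucceedsWithProbability≥ (A n D) σ (e ⁻¹ + ε) D))
theorem2 em R ε (0≤ε , 0≉ε) (A , succeeds) = 0≉ε (antisym 0≤ε (archimedean n*ε≤1))
  where
  open Reals R hiding (zero)
  open BestChoice R
  open OrderedField R
  open Exp semiring using (_^_)
  open Suprema em R
  open Exponential em R
  open MeasureProperties em R
  open LastHit em R
  open ≤-Reasoning

  module _ (j : ℕ) where
    -- Taking `k` positive makes `r` a genuine inverse.
    k = suc j
    p = fromℕ (suc k) ⁻¹
    q = fromℕ k * p
    r = fromℕ k ⁻¹

    0≤p : 0# ≤ p
    0≤p = ⁻¹-nonNeg (fromℕ-suc≉0 k) (fromℕ-nonNeg (suc k))
    0≤q : 0# ≤ q
    0≤q = *-nonNeg (fromℕ-nonNeg k) 0≤p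
    0≤r : 0# ≤ r
    0≤r = ⁻¹-nonNeg (fromℕ-suc≉0 j) (fromℕ-nonNeg k)
    suck*p≈1 : fromℕ (suc k) * p ≈ 1#
    suck*p≈1 = ⁻¹-inverseʳ (fromℕ-suc≉0 k)
    k*r≈1 : fromℕ k * r ≈ 1#
    k*r≈1 = ⁻¹-inverseʳ (fromℕ-suc≉0 j)
    p+q≈1 : p + q ≈ 1#
    p+q≈1 = begin-equality
      p + fromℕ k * p       ≈⟨ +-congʳ (*-identityˡ p) ⟨
      1# * p + fromℕ k * p  ≈⟨ distribʳ p 1# (fromℕ k) ⟨
      fromℕ (suc k) * p     ≈⟨ suck*p≈1 ⟩
      1#                    ∎
    q*r≈p : q * r ≈ p
    q*r≈p = begin-equality
      fromℕ k * p * r    ≈⟨ solve 3 (λ k p r → k :* p :* r := p :* (k :* r)) refl (fromℕ k) p r ⟩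
      p * (fromℕ k * r)  ≈⟨ *-congˡ k*r≈1 ⟩
      p * 1#             ≈⟨ *-identityʳ p ⟩
      p                  ∎
      where open Solver

    D : Instance (suc k)
    D = TwoPoint.distribution ∘ hardInstance 0≤p 0≤q 0≤r p+q≈1 q*r≈p

    ε≤p : ε ≤ p
    ε≤p = +-cancelʳ-≤ (e ⁻¹) (begin
      ε + e ⁻¹               ≈⟨ +-comm ε (e ⁻¹) ⟩
      e ⁻¹ + ε               ≤⟨ success≤q^k 0≤p 0≤q 0≤r p+q≈1 q*r≈p (≤-reflexive k*r≈1)
                                  (A (suc k) D) (succeeds (suc k) D Permutation.id) ⟩
      -- The comparison with 1/e applies to the exponent `suc k`, since that is the multiple of `p`
      -- equal to 1. Expanding by `p + q ≈ 1#` reaches this exponent at a cost of at most `p`.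
      q ^ k                  ≈⟨ *-identityˡ _ ⟨
      1# * q ^ k             ≈⟨ *-congʳ p+q≈1 ⟨
      (p + q) * q ^ k        ≈⟨ distribʳ _ p q ⟩
      p * q ^ k + q ^ suc k  ≤⟨ +-mono-≤ (*-monoʳ-≤ 0≤p (q^n-≤1 0≤p 0≤q p+q≈1 k))
                                         (q^n≤e⁻¹ 0≤p 0≤q p+q≈1 (suc k) suck*p≈1) ⟩
      p * 1# + e ⁻¹          ≈⟨ +-congʳ (*-identityʳ p) ⟩
      p + e ⁻¹               ∎)

  n*ε≤1 : ∀ n → fromℕ n * ε ≤ 1#
  n*ε≤1 n = begin
    -- At parameter `n` the success weight is 1/(n+2), so `n` is first enlarged to `2 ℕ.+ n` to
    -- cancel it. The uniform bound 1 on the multiples of `ε` then contradicts its positivity by the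
    -- Archimedean property.
    fromℕ n * ε               ≤⟨ *-monoˡ-≤ 0≤ε (fromℕ-mono-≤ (ℕ.m≤n+m n 2)) ⟩
    fromℕ (2 ℕ.+ n) * ε       ≤⟨ *-monoʳ-≤ (fromℕ-nonNeg (2 ℕ.+ n)) (ε≤p n) ⟩
    fromℕ (2 ℕ.+ n) * p n     ≈⟨ suck*p≈1 n ⟩
    1#                        ∎
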